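{- Any subgroup of a specular group is specular.
   Context: Let $A$ be a finite alphabet with an involution $\theta:A\to A$ (that is, $\theta\circ\theta=\mathrm{id}$), possibly with some fixed points. $G_\theta$ denotes the group generated by $A$ with the relations $a\,\theta(a)=1$ for every $a\in A$. It is a free product of a free group and a finite number of copies of $\mathbb{Z}/2\mathbb{Z}$, that is, $G_\theta=\mathbb{Z}^{*i}*(\mathbb{Z}/2\mathbb{Z})^{*j}$, where $i$ is the number of orbits of $\theta$ with two elements and $j$ is the number of its fixed points. Such a group is called a specular group (of type $(i,j)$).
   Formalization: With finite alphabets the claim fails (the commutator subgroup of the free group of rank 2 is not finitely generated); proved instead: every subgroup is a G_θ over a possibly infinite alphabet, and every finitely generated subgroup is specular with a finite alphabet. -}

module Defs where

open import Algebra.Bundles using (Group)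
open import Algebra.Definitions using (Involutive)
open import Algebra.Morphism.Structures using (module GroupMorphisms)
open import Data.Fin.Base using (Fin)
open import Data.Product.Base using (Σ; Σ-syntax; ∃-syntax; _×_; _,_; proj₁; proj₂)
open import Function.Base using (_on_)
open import Function.Bundles using (_↔_)
open import Level using (Level; _⊔_; 0ℓ) renaming (suc to lsuc)
open import Relation.Binary.PropositionalEquality.Core using (_≡_)
open import Relation.Unary using (Pred; _∈_)

private
  variable
    a c c₁ c₂ ℓ ℓ₁ ℓ₂ : Level

_≅_ : Group c₁ ℓ₁ → Group c₂ ℓ₂ → Set (c₁ ⊔ ℓ₁ ⊔ c₂ ⊔ ℓ₂)
G ≅ H = Σ[ f ∈ (Group.Carrier G → Group.Carrier H) ] IsGroupIsomorphism f
  where open GroupMorphisms (Group.rawGroup G) (Group.rawGroup H)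

data Term (A : Set a) : Set a where
  gen  : A → Term A
  ε′   : Term A
  _∙′_ : Term A → Term A → Term A
  inv  : Term A → Term A

eval : (G : Group c ℓ) {A : Set a} → (A → Group.Carrier G) → Term A → Group.Carrier G
eval G ρ (gen x)  = ρ x
eval G ρ ε′       = Group.ε G
eval G ρ (s ∙′ t) = Group._∙_ G (eval G ρ s) (eval G ρ t)
eval G ρ (inv t)  = Group._⁻¹ G (eval G ρ t)

-- The group presented by the generators A and the relations a · θ(a) = 1:
-- group terms over A modulo the least congruence containing the group laws
-- and these relations.
module _ {A : Set a} (θ : A → A) where

  infix 4 _≈θ_

  data _≈θ_ : Term A → Term A → Set a where
    ≈-refl      : ∀ {s} → s ≈θ s
    ≈-sym       : ∀ {s t} → s ≈θ t → t ≈θ s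
    ≈-trans     : ∀ {s t u} → s ≈θ t → t ≈θ u → s ≈θ u
    ≈-∙-cong    : ∀ {s s′ t t′} → s ≈θ s′ → t ≈θ t′ → (s ∙′ t) ≈θ (s′ ∙′ t′)
    ≈-inv-cong  : ∀ {s t} → s ≈θ t → inv s ≈θ inv t
    ≈-assoc     : ∀ s t u → ((s ∙′ t) ∙′ u) ≈θ (s ∙′ (t ∙′ u))
    ≈-identityˡ : ∀ s → (ε′ ∙′ s) ≈θ s
    ≈-identityʳ : ∀ s → (s ∙′ ε′) ≈θ s
    ≈-inverseˡ  : ∀ s → (inv s ∙′ s) ≈θ ε′
    ≈-inverseʳ  : ∀ s → (s ∙′ inv s) ≈θ ε′
    relation    : ∀ x → (gen x ∙′ gen (θ x)) ≈θ ε′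

  G[_] : Group a a
  G[_] = record
    { Carrier = Term A
    ; _≈_     = _≈θ_
    ; _∙_     = _∙′_
    ; ε       = ε′
    ; _⁻¹     = inv
    ; isGroup = record
      { isMonoid = record
        { isSemigroup = record
          { isMagma = record
            { isEquivalence = record { refl = ≈-refl ; sym = ≈-sym ; trans = ≈-trans }
            ; ∙-cong        = ≈-∙-cong
            }
          ; assoc = ≈-assoc
          }
        ; identity = ≈-identityˡ , ≈-identityʳ
        }
      ; inverse = ≈-inverseˡ , ≈-inverseʳ
      ; ⁻¹-cong = ≈-inv-cong
      }
    }

Finite : Set a → Set a
Finite A = ∃[ n ] (A ↔ Fin n)

SpecularOver : Set → Group c ℓ → Set (c ⊔ ℓ)
SpecularOver A G = Σ[ θ ∈ (A → A) ] (Involutive _≡_ θ × G ≅ G[ θ ])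

IsSpecular : Group c ℓ → Set (lsuc 0ℓ ⊔ c ⊔ ℓ)
IsSpecular G = Σ[ A ∈ Set ] (Finite A × SpecularOver A G)

-- As IsSpecular, but the alphabet may be infinite. A subgroup of a specular
-- group need not be finitely generated (e.g. the commutator subgroup of the
-- free group of rank 2), so it need not have a finite alphabet.
IsSpecular∞ : Group c ℓ → Set (lsuc 0ℓ ⊔ c ⊔ ℓ)
IsSpecular∞ G = Σ[ A ∈ Set ] SpecularOver A G

FinitelyGenerated : Group c ℓ → Set (c ⊔ ℓ)
FinitelyGenerated G =
  ∃[ n ] Σ[ g ∈ (Fin n → Carrier) ] (∀ x → Σ[ t ∈ Term (Fin n) ] eval G g t ≈ x)
  where open Group G

record Subgroup (G : Group c ℓ) (p : Level) : Set (c ⊔ ℓ ⊔ lsuc p) where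
  open Group G
  field
    Member    : Pred Carrier p
    resp      : ∀ {x y} → x ≈ y → x ∈ Member → y ∈ Member
    ε-closed  : ε ∈ Member
    ∙-closed  : ∀ {x y} → x ∈ Member → y ∈ Member → (x ∙ y) ∈ Member
    ⁻¹-closed : ∀ {x} → x ∈ Member → (x ⁻¹) ∈ Member

  group : Group (c ⊔ p) ℓ
  group = record
    { Carrier = Σ Carrier Member
    ; _≈_     = _≈_ on proj₁
    ; _∙_     = λ (x , x∈) (y , y∈) → (x ∙ y) , ∙-closed x∈ y∈
    ; ε       = ε , ε-closed
    ; _⁻¹     = λ (x , x∈) → (x ⁻¹) , ⁻¹-closed x∈
    ; isGroup = record
      { isMonoid = record
        { isSemigroup = record
          { isMagma = record
            { isEquivalence = record { refl = refl ; sym = sym ; trans = trans }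
            ; ∙-cong        = ∙-cong
            }
          ; assoc = λ x y z → assoc (proj₁ x) (proj₁ y) (proj₁ z)
          }
        ; identity = (λ x → identityˡ (proj₁ x)) , (λ x → identityʳ (proj₁ x))
        }
      ; inverse = (λ x → inverseˡ (proj₁ x)) , (λ x → inverseʳ (proj₁ x))
      ; ⁻¹-cong = ⁻¹-cong
      }
    }

{-# OPTIONS --safe #-}
module Submission where

-- Reidemeister–Schreier.  For a subgroup H of G[ θ ], the Schreier graph of the
-- right cosets of H has edges (v , a) : v → v·a, with the involution
-- (v , a) ↦ (v·a , θ a).  Choosing in every coset the word that is minimal for a
-- right-invariant well-order gives a spanning tree, and H is presented by the
-- edges outside the tree with that same involution: a fixed point is a loop
-- labelled by a fixed letter of θ.  If H is finitely generated, only finitely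
-- many edges occur in the generators, and any other edge would be detected by
-- the homomorphism to ℤ/2 counting its occurrences modulo 2.

open import Defs
open import Algebra.Bundles using (Group)
open import Algebra.Definitions using (Involutive)
open import Algebra.Morphism.Construct.Composition using (isGroupIsomorphism)
open import Algebra.Morphism.Structures using (module GroupMorphisms)
import Algebra.Properties.Group as GroupProperties
open import Axiom.ExcludedMiddle using (ExcludedMiddle)
open import Data.Bool.Base using (Bool; true; false; _xor_; _∨_)
open import Data.Bool.Properties using (xor-same; xor-assoc; xor-identityʳ; ∨-comm)
open import Data.Fin.Base using (Fin; toℕ)
import Data.Fin.Base as Fin
open import Data.Fin.Properties using (toℕ<n; toℕ-injective; nonZeroIndex)
import Data.Fin.Properties as Fin
open import Data.List.Base using (List; []; _∷_; _++_; map; concatMap; allFin; lookup; length; deduplicate)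
open import Data.List.Membership.Propositional using () renaming (_∈_ to _∈ˡ_)
open import Data.List.Membership.Propositional.Properties using (∈-++⁺ˡ; ∈-++⁺ʳ; ∈-map⁺; ∈-concatMap⁺; ∈-allFin; ∈-lookup; ∈-deduplicate⁺)
import Data.List.Membership.DecPropositional as DecMembership
open import Data.List.Properties using (≡-dec)
import Data.List.Relation.Unary.All as All
open import Data.List.Relation.Unary.AllPairs using ([]; _∷_)
open import Data.List.Relation.Unary.Any using (here; index)
import Data.List.Relation.Unary.Any as Any
open import Data.List.Relation.Unary.Any.Properties using (lookup-index)
open import Data.List.Relation.Unary.Unique.Propositional using (Unique)
open import Data.List.Relation.Unary.Unique.DecPropositional.Properties using (deduplicate-!)
open import Data.Nat.Base using (ℕ; zero; suc; _+_; _*_; _≤_; z≤n; s≤s; s≤s⁻¹; NonZero)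
open import Data.Nat.DivMod using (_%_; [m+kn]%n≡m%n; m<n⇒m%n≡m)
open import Data.Nat.Properties using (≤-antisym; suc-injective; +-cancelˡ-≡; +-cancelˡ-≤; *-cancelʳ-≡; *-cancelʳ-≤; n≤0⇒n≡0)
open import Data.Product.Base using (Σ; Σ-syntax; ∃-syntax; _×_; _,_; proj₁; proj₂)
open import Data.Sum.Base using (_⊎_; inj₁; inj₂)
open import Function.Base using (_∘_)
open import Function.Bundles using (_↣_; mk↔ₛ′; module Injection)
open import Function.Properties.Inverse using (↔⇒↣)
open import Level using (Level)
open import Relation.Binary.Definitions using (DecidableEquality)
open import Relation.Binary.PropositionalEquality using (_≡_; _≢_; refl; sym; trans; cong; cong₂; subst)
import Relation.Binary.Reasoning.Setoid as SetoidReasoning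
open import Relation.Nullary.Decidable using (Dec; yes; no; does; map′; _×-dec_; _⊎-dec_; recompute; via-injection; dec-true; dec-false)
open import Relation.Nullary.Negation using (¬_; contradiction; contradiction-irr)
open import Relation.Unary using (Pred; Decidable)

private
  variable
    a c c₁ c₂ c₃ ℓ ℓ₁ ℓ₂ ℓ₃ p : Level

-- Least witnesses and finite enumerations

least : {P : Pred ℕ p} → Decidable P → ∀ n → P n →
        ∃[ m ] (P m × (∀ k → P k → m ≤ k))
least P? n Pn with P? 0
least P? n       Pn | yes P0 = 0 , P0 , λ _ _ → z≤n
least P? zero    Pn | no ¬P0 = contradiction Pn ¬P0
least P? (suc n) Pn | no ¬P0 with least (P? ∘ suc) n Pn
... | m , Pm , m≤ = suc m , Pm , λ where
  zero    P0 → contradiction P0 ¬P0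
  (suc k) Pk → s≤s (m≤ k Pk)

lookup-injective : {A : Set a} {xs : List A} → Unique xs →
                   ∀ i j → lookup xs i ≡ lookup xs j → i ≡ j
lookup-injective (_ ∷ _) Fin.zero Fin.zero _ = refl
lookup-injective {xs = _ ∷ xs} (x≢ ∷ _) Fin.zero (Fin.suc j) eq =
  contradiction eq (All.lookup x≢ (∈-lookup {xs = xs} j))
lookup-injective {xs = _ ∷ xs} (x≢ ∷ _) (Fin.suc i) Fin.zero eq =
  contradiction (sym eq) (All.lookup x≢ (∈-lookup {xs = xs} i))
lookup-injective (_ ∷ u) (Fin.suc i) (Fin.suc j) eq =
  cong Fin.suc (lookup-injective u i j eq)

enumerated⇒finite : {A : Set a} → DecidableEquality A →
                    (xs : List A) → (∀ x → x ∈ˡ xs) → Finite A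
enumerated⇒finite _≟_ xs _∈xs = length ys , mk↔ₛ′ (index ∘ _∈ys) (lookup ys)
  (λ i → lookup-injective (deduplicate-! _≟_ xs) _ i (sym (lookup-index (lookup ys i ∈ys))))
  (λ x → sym (lookup-index (x ∈ys)))
  where
  ys = deduplicate _≟_ xs
  _∈ys : ∀ x → x ∈ˡ ys
  x ∈ys = ∈-deduplicate⁺ _≟_ (x ∈xs)

-- Bijective base-n numeration, least significant digit first.
module Numeration {A : Set} {n : ℕ} (ix : A ↣ Fin n) where

  open Injection ix using (to; injective)

  digit : A → ℕ
  digit x = toℕ (to x)

  code : List A → ℕ
  code []      = 0
  code (x ∷ u) = suc (digit x + code u * n)

  private
    -- A letter itself witnesses that `n` is positive, so the empty alphabet needs no separate case.
    n≢0 : A → NonZero n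
    n≢0 x = nonZeroIndex (to x)

  digit-injective : ∀ {x y} i j → digit x + i * n ≡ digit y + j * n → x ≡ y
  digit-injective {x} {y} i j eq = injective (toℕ-injective
    (trans (sym (mod x i)) (trans (cong (λ k → _%_ k n {{n≢0 x}}) eq) (mod y j))))
    where
    mod : ∀ z k → _%_ (digit z + k * n) n {{n≢0 x}} ≡ digit z
    mod z k = trans ([m+kn]%n≡m%n (digit z) k n {{n≢0 x}}) (m<n⇒m%n≡m {{n≢0 x}} (toℕ<n (to z)))

  code-injective : ∀ u v → code u ≡ code v → u ≡ v
  code-injective []      []      _  = refl
  code-injective (x ∷ u) (y ∷ v) eq with digit-injective (code u) (code v) (suc-injective eq)
  ... | refl = cong (x ∷_) (code-injective u v
    (*-cancelʳ-≡ _ _ n {{n≢0 x}} (+-cancelˡ-≡ (digit x) _ _ (suc-injective eq))))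

  -- The map sending `k` to `1 + d + k * n` reflects the order. For words stored last letter first,
  -- comparing codes is the shortlex order, and this is its right-invariance.
  code-∷-cancel-≤ : ∀ x u v → code (x ∷ u) ≤ code (x ∷ v) → code u ≤ code v
  code-∷-cancel-≤ x u v le = *-cancelʳ-≤ _ _ n {{n≢0 x}} (+-cancelˡ-≤ (digit x) _ _ (s≤s⁻¹ le))

-- Evaluation of terms in a group

module _ {A : Set a} {θ : A → A} (G : Group c ℓ) where

  open Group G using (_≈_; _∙_; ε) renaming (Carrier to ∣G∣)
  private module G = Group G

  -- The universal property of the presentation: every constructor except `relation` is a law of all
  -- groups.
  eval-cong : {ρ : A → ∣G∣} → (∀ x → ρ x ∙ ρ (θ x) ≈ ε) →
              ∀ {s t} → _≈θ_ θ s t → eval G ρ s ≈ eval G ρ t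
  eval-cong rel ≈-refl            = G.refl
  eval-cong rel (≈-sym s≈t)       = G.sym (eval-cong rel s≈t)
  eval-cong rel (≈-trans s≈t t≈u) = G.trans (eval-cong rel s≈t) (eval-cong rel t≈u)
  eval-cong rel (≈-∙-cong s≈ t≈)  = G.∙-cong (eval-cong rel s≈) (eval-cong rel t≈)
  eval-cong rel (≈-inv-cong s≈t)  = G.⁻¹-cong (eval-cong rel s≈t)
  eval-cong rel (≈-assoc s t u)   = G.assoc _ _ _
  eval-cong rel (≈-identityˡ s)   = G.identityˡ _
  eval-cong rel (≈-identityʳ s)   = G.identityʳ _
  eval-cong rel (≈-inverseˡ s)    = G.inverseˡ _
  eval-cong rel (≈-inverseʳ s)    = G.inverseʳ _
  eval-cong rel (relation x)      = rel x

-- Right cosets of a subgroup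

module Cosets {G : Group c ℓ} (H : Subgroup G p) where

  open Group G renaming (refl to ≈refl; sym to ≈sym; trans to ≈trans)
  open GroupProperties G
  open Subgroup H
  open SetoidReasoning setoid

  infix 4 _∼_
  _∼_ : Carrier → Carrier → Set p
  x ∼ y = Member (x ∙ y ⁻¹)

  ≈⇒∼ : ∀ {x y} → x ≈ y → x ∼ y
  ≈⇒∼ x≈y = resp (≈sym (x≈y⇒x∙y⁻¹≈ε x≈y)) ε-closed

  ∼-sym : ∀ {x y} → x ∼ y → y ∼ x
  ∼-sym {x} {y} h = resp (begin
    (x ∙ y ⁻¹) ⁻¹   ≈⟨ ⁻¹-anti-homo-∙ x (y ⁻¹) ⟩
    y ⁻¹ ⁻¹ ∙ x ⁻¹  ≈⟨ ∙-congʳ (⁻¹-involutive y) ⟩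
    y ∙ x ⁻¹        ∎) (⁻¹-closed h)

  ∼-trans : ∀ {x y z} → x ∼ y → y ∼ z → x ∼ z
  ∼-trans {x} {y} {z} h k = resp (begin
    (x ∙ y ⁻¹) ∙ (y ∙ z ⁻¹)  ≈⟨ assoc _ _ _ ⟨
    ((x ∙ y ⁻¹) ∙ y) ∙ z ⁻¹  ≈⟨ ∙-congʳ (//-rightDividesˡ y x) ⟩
    x ∙ z ⁻¹                 ∎) (∙-closed h k)

  ∼-∙ʳ : ∀ {x y} z → x ∼ y → x ∙ z ∼ y ∙ z
  ∼-∙ʳ {x} {y} z h = resp (begin
    x ∙ y ⁻¹                 ≈⟨ ∙-congʳ (//-rightDividesʳ z x) ⟨
    ((x ∙ z) ∙ z ⁻¹) ∙ y ⁻¹  ≈⟨ assoc _ _ _ ⟩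
    (x ∙ z) ∙ (z ⁻¹ ∙ y ⁻¹)  ≈⟨ ∙-congˡ (⁻¹-anti-homo-∙ y z) ⟨
    (x ∙ z) ∙ (y ∙ z) ⁻¹     ∎) h

  Member⇒∼ε : ∀ {x} → Member x → x ∼ ε
  Member⇒∼ε {x} = resp (begin
    x          ≈⟨ identityʳ x ⟨
    x ∙ ε      ≈⟨ ∙-congˡ ε⁻¹≈ε ⟨
    x ∙ ε ⁻¹   ∎)

module Schreier {A : Set} {n : ℕ} (em : ExcludedMiddle p) (ix : A ↣ Fin n)
                {θ : A → A} (θ-inv : Involutive _≡_ θ) (H : Subgroup G[ θ ] p) where

  open Group G[ θ ] renaming (refl to ≈refl; sym to ≈sym; trans to ≈trans)
  open GroupProperties G[ θ ]
  open Subgroup H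
  open Cosets H
  open Numeration ix
  open SetoidReasoning setoid

  -- Words representing terms

  infix 4 _≟_
  _≟_ : DecidableEquality (List A)
  _≟_ = ≡-dec (via-injection ix Fin._≟_)

  -- Words are stored with their last letter first.
  ⟦_⟧ : List A → Term A
  ⟦ [] ⟧    = ε′
  ⟦ x ∷ u ⟧ = ⟦ u ⟧ ∙′ gen x

  ⟦⟧-++ : ∀ u v → ⟦ u ++ v ⟧ ≈ ⟦ v ⟧ ∙ ⟦ u ⟧
  ⟦⟧-++ []      v = ≈sym (identityʳ _)
  ⟦⟧-++ (x ∷ u) v = ≈trans (∙-congʳ (⟦⟧-++ u v)) (assoc _ _ _)

  relationˡ : ∀ x → gen (θ x) ∙ gen x ≈ ε
  relationˡ x = subst (λ y → gen (θ x) ∙ gen y ≈ ε) (θ-inv x) (relation (θ x))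

  -- The letter `θ x` is inverse to `x`, so words without formal inverses suffice.
  word-inverse : ∀ u → ∃[ v ] ⟦ v ⟧ ≈ ⟦ u ⟧ ⁻¹
  word-inverse []      = [] , ≈sym ε⁻¹≈ε
  word-inverse (x ∷ u) with word-inverse u
  ... | v , v≈u⁻¹ = v ++ θ x ∷ [] , (begin
    ⟦ v ++ θ x ∷ [] ⟧       ≈⟨ ⟦⟧-++ v (θ x ∷ []) ⟩
    (ε ∙ gen (θ x)) ∙ ⟦ v ⟧ ≈⟨ ∙-cong (identityˡ _) v≈u⁻¹ ⟩
    gen (θ x) ∙ ⟦ u ⟧ ⁻¹    ≈⟨ ∙-congʳ (inverseˡ-unique _ _ (relationˡ x)) ⟩
    gen x ⁻¹ ∙ ⟦ u ⟧ ⁻¹     ≈⟨ ⁻¹-anti-homo-∙ ⟦ u ⟧ (gen x) ⟨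
    (⟦ u ⟧ ∙ gen x) ⁻¹      ∎)

  term-word : ∀ t → ∃[ u ] ⟦ u ⟧ ≈ t
  term-word (gen x)  = x ∷ [] , identityˡ _
  term-word ε′       = [] , ≈refl
  term-word (s ∙′ t) with term-word s | term-word t
  ... | u , u≈s | v , v≈t = v ++ u , ≈trans (⟦⟧-++ v u) (∙-cong u≈s v≈t)
  term-word (inv t)  with term-word t
  ... | u , u≈t with word-inverse u
  ... | v , v≈u⁻¹ = v , ≈trans v≈u⁻¹ (⁻¹-cong u≈t)

  -- Minimal coset representatives

  private
    -- Excluded middle decides whether some word of a given code lies in the coset of `s`; this is
    -- its only use.
    least-rep : ∀ s → ∃[ k ] ((Σ[ u ∈ List A ] (code u ≡ k × ⟦ u ⟧ ∼ s)) ×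
                              (∀ j → (Σ[ u ∈ List A ] (code u ≡ j × ⟦ u ⟧ ∼ s)) → k ≤ j))
    least-rep s with term-word s
    ... | u , u≈s = least (λ _ → em) (code u) (u , refl , ≈⇒∼ u≈s)

  abstract
    rep : Term A → List A
    rep s = proj₁ (proj₁ (proj₂ (least-rep s)))

    rep-∼ : ∀ s → ⟦ rep s ⟧ ∼ s
    rep-∼ s = proj₂ (proj₂ (proj₁ (proj₂ (least-rep s))))

    rep-least : ∀ {s} u → ⟦ u ⟧ ∼ s → code (rep s) ≤ code u
    rep-least {s} u u∼s = subst (_≤ code u) (sym (proj₁ (proj₂ (proj₁ (proj₂ (least-rep s))))))
      (proj₂ (proj₂ (least-rep s)) (code u) (u , refl , u∼s))

  rep-cong : ∀ {s t} → s ∼ t → rep s ≡ rep t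
  rep-cong {s} {t} s∼t = code-injective _ _ (≤-antisym
    (rep-least (rep t) (∼-trans (rep-∼ t) (∼-sym s∼t)))
    (rep-least (rep s) (∼-trans (rep-∼ s) s∼t)))

  -- A coset is named by its minimal word. This keeps the graph in `Set` whatever the level of
  -- `Member`, and being a vertex becomes a decidable equation between words.
  Vertex : List A → Set
  Vertex u = rep ⟦ u ⟧ ≡ u

  rep-vertex : ∀ s → Vertex (rep s)
  rep-vertex s = rep-cong (rep-∼ s)

  []-vertex : Vertex []
  []-vertex = code-injective _ _ (n≤0⇒n≡0 (rep-least [] (≈⇒∼ ≈refl)))

  -- The Schreier property: minimal words are closed under prefixes. Replacing the prefix `u` by its
  -- representative stays in the coset of `x ∷ u`, so minimality of `x ∷ u` and cancellation of `x`
  -- make `u` minimal.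
  vertex-tail : ∀ {x u} → Vertex (x ∷ u) → Vertex u
  vertex-tail {x} {u} xu = code-injective _ _ (≤-antisym
    (rep-least u (≈⇒∼ ≈refl))
    (code-∷-cancel-≤ x u (rep ⟦ u ⟧) (subst (λ w → code w ≤ code (x ∷ rep ⟦ u ⟧)) xu
      (rep-least (x ∷ rep ⟦ u ⟧) (∼-∙ʳ (gen x) (rep-∼ ⟦ u ⟧))))))

  -- The Schreier graph, its spanning tree and the remaining edges

  target : List A → A → List A
  target u x = rep (⟦ u ⟧ ∙ gen x)

  target-rep : ∀ s x → target (rep s) x ≡ rep (s ∙ gen x)
  target-rep s x = rep-cong (∼-∙ʳ (gen x) (rep-∼ s))

  target-target : ∀ {u} x → Vertex u → target (target u x) (θ x) ≡ u
  target-target {u} x uv = trans (target-rep (⟦ u ⟧ ∙ gen x) (θ x)) (trans (rep-cong (≈⇒∼ (begin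
    (⟦ u ⟧ ∙ gen x) ∙ gen (θ x)  ≈⟨ assoc _ _ _ ⟩
    ⟦ u ⟧ ∙ (gen x ∙ gen (θ x))  ≈⟨ ∙-congˡ (relation x) ⟩
    ⟦ u ⟧ ∙ ε                    ≈⟨ identityʳ _ ⟩
    ⟦ u ⟧                        ∎))) uv)

  -- The tree joins each non-empty minimal word to its longest proper prefix. The two summands are
  -- the two orientations of such an edge, and reversal exchanges them.
  Tree : List A → A → Set
  Tree u x = target u x ≡ x ∷ u ⊎ u ≡ θ x ∷ target u x

  tree? : ∀ u x → Dec (Tree u x)
  tree? u x = (target u x ≟ x ∷ u) ⊎-dec (u ≟ θ x ∷ target u x)

  tree-flip : ∀ {u} x → Vertex u → Tree u x → Tree (target u x) (θ x)
  tree-flip {u} x uv (inj₁ eq) = inj₂ (trans eq (cong₂ _∷_ (sym (θ-inv x)) (sym (target-target x uv))))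
  tree-flip {u} x uv (inj₂ eq) = inj₁ (trans (target-target x uv) eq)

  tree-unflip : ∀ {u} x → Vertex u → Tree (target u x) (θ x) → Tree u x
  tree-unflip {u} x uv (inj₁ eq) = inj₂ (trans (sym (target-target x uv)) eq)
  tree-unflip {u} x uv (inj₂ eq) = inj₁ (trans eq (cong₂ _∷_ (θ-inv x) (target-target x uv)))

  -- Along a tree edge the representatives agree in the group itself, not just up to the subgroup;
  -- hence tree edges may be read as trivial.
  tree-≈ : ∀ u x → Tree u x → ⟦ target u x ⟧ ≈ ⟦ u ⟧ ∙ gen x
  tree-≈ u x (inj₁ eq) rewrite eq = ≈refl
  tree-≈ u x (inj₂ eq) = begin
    ⟦ target u x ⟧                          ≈⟨ identityʳ _ ⟨
    ⟦ target u x ⟧ ∙ ε                      ≈⟨ ∙-congˡ (relationˡ x) ⟨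
    ⟦ target u x ⟧ ∙ (gen (θ x) ∙ gen x)    ≈⟨ assoc _ _ _ ⟨
    ⟦ θ x ∷ target u x ⟧ ∙ gen x            ≡⟨ cong (λ w → ⟦ w ⟧ ∙ gen x) eq ⟨
    ⟦ u ⟧ ∙ gen x                           ∎

  -- The proofs are irrelevant so that source and label alone determine an edge. The vertex proof
  -- can be recovered by `recompute`, since word equality is decidable.
  record Edge : Set where
    constructor edge
    field
      source   : List A
      label    : A
      .vertex  : Vertex source
      .nontree : ¬ Tree source label

  edge-≡ : ∀ {u v x y} .{uv : Vertex u} .{vv : Vertex v} .{ux : ¬ Tree u x} .{vy : ¬ Tree v y} →
           u ≡ v → x ≡ y → edge u x uv ux ≡ edge v y vv vy
  edge-≡ refl refl = refl

  _≟ᵉ_ : DecidableEquality Edge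
  edge u x _ _ ≟ᵉ edge v y _ _ =
    map′ (λ (u≡v , x≡y) → edge-≡ u≡v x≡y) (λ eq → cong Edge.source eq , cong Edge.label eq)
      ((u ≟ v) ×-dec via-injection ix Fin._≟_ x y)

  flip : Edge → Edge
  flip (edge u x uv ux) = edge (target u x) (θ x) (rep-vertex _) (λ t → ux (tree-unflip x uv t))

  flip-involutive : Involutive _≡_ flip
  flip-involutive (edge u x uv ux) = edge-≡ (target-target x (recompute (_ ≟ _) uv)) (θ-inv x)

  -- Reidemeister rewriting

  private
    module F = Group G[ flip ]
    module FP = GroupProperties G[ flip ]

  letter : ∀ u → .(Vertex u) → A → Term Edge
  letter u uv x with tree? u x
  ... | yes _ = ε′
  ... | no ux = gen (edge u x uv ux)

  letter-cong : ∀ {u v} .{uv : Vertex u} .{vv : Vertex v} x → u ≡ v → letter u uv x ≡ letter v vv x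
  letter-cong x refl = refl

  letter-tree : ∀ {u} .{uv : Vertex u} x → Tree u x → letter u uv x ≡ ε′
  letter-tree {u} x ux with tree? u x
  ... | yes _  = refl
  ... | no ¬ux = contradiction ux ¬ux

  letter-edge : ∀ {u} .{uv : Vertex u} x .(ux : ¬ Tree u x) → letter u uv x ≡ gen (edge u x uv ux)
  letter-edge {u} x ux with tree? u x
  ... | yes t = contradiction-irr ux (λ ¬t → ¬t t)
  ... | no _  = refl

  -- The tree is closed under reversal, so an edge and its reverse are both dropped or both kept.
  letter-relation : ∀ {u} (uv : Vertex u) x →
                    letter u uv x F.∙ letter (target u x) (rep-vertex _) (θ x) F.≈ F.ε
  letter-relation {u} uv x with tree? u x | tree? (target u x) (θ x)
  ... | yes _  | yes _  = F.identityˡ _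
  ... | yes t  | no ¬t  = contradiction (tree-flip x uv t) ¬t
  ... | no ¬t  | yes t  = contradiction (tree-unflip x uv t) ¬t
  -- The second generator is `flip` of the first, up to irrelevant proofs.
  ... | no ux  | no _   = relation (edge u x uv ux)

  -- The label of the path spelled by a term, starting at the coset of r.
  rewriting : Term A → Term A → Term Edge
  rewriting r (gen x)  = letter (rep r) (rep-vertex r) x
  rewriting r ε′       = ε′
  rewriting r (s ∙′ t) = rewriting r s ∙′ rewriting (r ∙′ s) t
  -- The path of `t` that starts at `r ∙′ inv t` ends at `r`; it is traversed backwards.
  rewriting r (inv t)  = inv (rewriting (r ∙′ inv t) t)

  -- The base point enters only through its representative, so the two results are literally the
  -- same term.
  rewriting-∼ : ∀ {r r′} → r ∼ r′ → ∀ t → rewriting r t ≡ rewriting r′ t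
  rewriting-∼ h (gen x)  = letter-cong x (rep-cong h)
  rewriting-∼ h ε′       = refl
  rewriting-∼ h (s ∙′ t) = cong₂ _∙′_ (rewriting-∼ h s) (rewriting-∼ (∼-∙ʳ s h) t)
  rewriting-∼ h (inv t)  = cong inv (rewriting-∼ (∼-∙ʳ (inv t) h) t)

  rewriting-≈ : ∀ {r r′} → r ≈ r′ → ∀ t → rewriting r t F.≈ rewriting r′ t
  rewriting-≈ h t = F.reflexive (rewriting-∼ (≈⇒∼ h) t)

  -- Each group law turns into the same law for edge terms, once base points are moved within their
  -- cosets; the defining relations are handled by `letter-relation`.
  rewriting-cong : ∀ r {s t} → s ≈ t → rewriting r s F.≈ rewriting r t
  rewriting-cong r ≈-refl          = ≈-refl
  rewriting-cong r (≈-sym h)       = ≈-sym (rewriting-cong r h)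
  rewriting-cong r (≈-trans h k)   = ≈-trans (rewriting-cong r h) (rewriting-cong r k)
  rewriting-cong r (≈-∙-cong {s′ = s′} {t = t} h k) = F.∙-cong (rewriting-cong r h)
    (F.trans (rewriting-≈ (∙-congˡ h) t) (rewriting-cong (r ∙ s′) k))
  rewriting-cong r (≈-inv-cong {s} {t} h) = F.⁻¹-cong
    (F.trans (rewriting-≈ (∙-congˡ (⁻¹-cong h)) s) (rewriting-cong (r ∙ inv t) h))
  rewriting-cong r (≈-assoc s t u) =
    F.trans (F.assoc _ _ _) (F.∙-congˡ (F.∙-congˡ (rewriting-≈ (≈sym (assoc r s t)) u)))
  rewriting-cong r (≈-identityˡ s) = F.trans (F.identityˡ _) (rewriting-≈ (identityʳ r) s)
  rewriting-cong r (≈-identityʳ s) = F.identityʳ _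
  rewriting-cong r (≈-inverseˡ s)  = F.inverseˡ _
  rewriting-cong r (≈-inverseʳ s)  =
    F.trans (F.∙-congˡ (F.⁻¹-cong (rewriting-≈ (//-rightDividesʳ s r) s))) (F.inverseʳ _)
  rewriting-cong r (relation x)    =
    F.trans (F.∙-congˡ (F.reflexive (letter-cong (θ x) (sym (target-rep r x)))))
      (letter-relation (rep-vertex r) x)

  -- A member spells a closed path at the base coset, so whatever follows it starts there again.
  -- This makes rewriting multiplicative on the subgroup.
  rewriting-member : ∀ {r} → Member r → ∀ t → rewriting (ε ∙ r) t ≡ rewriting ε t
  rewriting-member h t = rewriting-∼ (∼-trans (≈⇒∼ (identityˡ _)) (Member⇒∼ε h)) t

  -- By prefix closure the path of a minimal word never leaves the tree.
  rewriting-vertex : ∀ u → Vertex u → rewriting ε ⟦ u ⟧ F.≈ F.ε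
  rewriting-vertex []      _  = F.refl
  rewriting-vertex (x ∷ u) xu = F.trans (F.∙-cong (rewriting-vertex u uv) (F.reflexive
    (trans (letter-cong {vv = uv} x (trans (rep-cong (≈⇒∼ (identityˡ _))) uv)) (letter-tree x (inj₁ xu)))))
    (F.identityˡ _)
    where uv = vertex-tail xu

  -- Schreier generators and the inverse of rewriting

  cycle : Edge → Σ (Term A) Member
  cycle (edge u x _ _) = (⟦ u ⟧ ∙ gen x) ∙ ⟦ target u x ⟧ ⁻¹ , ∼-sym (rep-∼ _)

  realise : Term Edge → Σ (Term A) Member
  realise = eval group cycle

  -- A cycle follows the tree to the source, crosses the edge and returns through the tree. The
  -- reversed edge gives the same loop backwards, so the product telescopes.
  cycle-relation : ∀ e → proj₁ (cycle e) ∙ proj₁ (cycle (flip e)) ≈ ε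
  cycle-relation (edge u x uv _) = begin
    ((⟦ u ⟧ ∙ gen x) ∙ v ⁻¹) ∙ ((v ∙ gen (θ x)) ∙ ⟦ target (target u x) (θ x) ⟧ ⁻¹)
      ≡⟨ cong (λ w → ((⟦ u ⟧ ∙ gen x) ∙ v ⁻¹) ∙ ((v ∙ gen (θ x)) ∙ ⟦ w ⟧ ⁻¹))
           (target-target x (recompute (_ ≟ _) uv)) ⟩
    ((⟦ u ⟧ ∙ gen x) ∙ v ⁻¹) ∙ ((v ∙ gen (θ x)) ∙ ⟦ u ⟧ ⁻¹)
      ≈⟨ assoc _ _ _ ⟩
    (⟦ u ⟧ ∙ gen x) ∙ (v ⁻¹ ∙ ((v ∙ gen (θ x)) ∙ ⟦ u ⟧ ⁻¹))
      ≈⟨ ∙-congˡ (∙-congˡ (assoc _ _ _)) ⟩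
    (⟦ u ⟧ ∙ gen x) ∙ (v ⁻¹ ∙ (v ∙ (gen (θ x) ∙ ⟦ u ⟧ ⁻¹)))
      ≈⟨ ∙-congˡ (\\-leftDividesʳ v _) ⟩
    (⟦ u ⟧ ∙ gen x) ∙ (gen (θ x) ∙ ⟦ u ⟧ ⁻¹)
      ≈⟨ ∙-congˡ (∙-congʳ (inverseʳ-unique _ _ (relation x))) ⟩
    (⟦ u ⟧ ∙ gen x) ∙ (gen x ⁻¹ ∙ ⟦ u ⟧ ⁻¹)
      ≈⟨ ∙-congˡ (⁻¹-anti-homo-∙ ⟦ u ⟧ (gen x)) ⟨
    (⟦ u ⟧ ∙ gen x) ∙ (⟦ u ⟧ ∙ gen x) ⁻¹
      ≈⟨ inverseʳ _ ⟩
    ε ∎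
    where v = ⟦ target u x ⟧

  realise-cong : ∀ {s t} → s F.≈ t → proj₁ (realise s) ≈ proj₁ (realise t)
  realise-cong = eval-cong group cycle-relation

  realise-letter : ∀ {u} (uv : Vertex u) x →
                   proj₁ (realise (letter u uv x)) ∙ ⟦ target u x ⟧ ≈ ⟦ u ⟧ ∙ gen x
  realise-letter {u} uv x with tree? u x
  ... | yes t = ≈trans (identityˡ _) (tree-≈ u x t)
  ... | no _  = //-rightDividesˡ _ _

  -- Subterms of a member need not be members, so the induction is on paths between arbitrary
  -- cosets, with the representatives of both ends as correction. For a member both ends are the
  -- base coset, represented by the empty word.
  realise-rewriting-∙ : ∀ r t → proj₁ (realise (rewriting r t)) ∙ ⟦ rep (r ∙ t) ⟧ ≈ ⟦ rep r ⟧ ∙ t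
  realise-rewriting-∙ r (gen x) =
    subst (λ w → proj₁ (realise (rewriting r (gen x))) ∙ ⟦ w ⟧ ≈ ⟦ rep r ⟧ ∙ gen x)
      (target-rep r x) (realise-letter (rep-vertex r) x)
  realise-rewriting-∙ r ε′ = begin
    ε ∙ ⟦ rep (r ∙ ε) ⟧  ≈⟨ identityˡ _ ⟩
    ⟦ rep (r ∙ ε) ⟧      ≡⟨ cong ⟦_⟧ (rep-cong (≈⇒∼ (identityʳ r))) ⟩
    ⟦ rep r ⟧            ≈⟨ identityʳ _ ⟨
    ⟦ rep r ⟧ ∙ ε        ∎
  realise-rewriting-∙ r (s ∙′ t) = begin
    (S ∙ T) ∙ ⟦ rep (r ∙ (s ∙ t)) ⟧  ≡⟨ cong (λ w → (S ∙ T) ∙ ⟦ w ⟧) (rep-cong (≈⇒∼ (assoc r s t))) ⟨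
    (S ∙ T) ∙ ⟦ rep ((r ∙ s) ∙ t) ⟧  ≈⟨ assoc _ _ _ ⟩
    S ∙ (T ∙ ⟦ rep ((r ∙ s) ∙ t) ⟧)  ≈⟨ ∙-congˡ (realise-rewriting-∙ (r ∙ s) t) ⟩
    S ∙ (⟦ rep (r ∙ s) ⟧ ∙ t)        ≈⟨ assoc _ _ _ ⟨
    (S ∙ ⟦ rep (r ∙ s) ⟧) ∙ t        ≈⟨ ∙-congʳ (realise-rewriting-∙ r s) ⟩
    (⟦ rep r ⟧ ∙ s) ∙ t              ≈⟨ assoc _ _ _ ⟩
    ⟦ rep r ⟧ ∙ (s ∙ t)              ∎
    where
    S = proj₁ (realise (rewriting r s))
    T = proj₁ (realise (rewriting (r ∙ s) t))
  realise-rewriting-∙ r (inv t) = begin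
    T ⁻¹ ∙ Q                            ≈⟨ ∙-congˡ (//-rightDividesʳ t Q) ⟨
    T ⁻¹ ∙ ((Q ∙ t) ∙ t ⁻¹)             ≈⟨ ∙-congˡ (∙-congʳ (realise-rewriting-∙ (r ∙ t ⁻¹) t)) ⟨
    T ⁻¹ ∙ ((T ∙ ⟦ rep ((r ∙ t ⁻¹) ∙ t) ⟧) ∙ t ⁻¹)
      ≡⟨ cong (λ w → T ⁻¹ ∙ ((T ∙ ⟦ w ⟧) ∙ t ⁻¹)) (rep-cong (≈⇒∼ (//-rightDividesˡ t r))) ⟩
    T ⁻¹ ∙ ((T ∙ ⟦ rep r ⟧) ∙ t ⁻¹)     ≈⟨ ∙-congˡ (assoc _ _ _) ⟩
    T ⁻¹ ∙ (T ∙ (⟦ rep r ⟧ ∙ t ⁻¹))     ≈⟨ \\-leftDividesʳ T _ ⟩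
    ⟦ rep r ⟧ ∙ t ⁻¹                    ∎
    where
    T = proj₁ (realise (rewriting (r ∙ t ⁻¹) t))
    Q = ⟦ rep (r ∙ t ⁻¹) ⟧

  realise-rewriting : ∀ {t} → Member t → proj₁ (realise (rewriting ε t)) ≈ t
  realise-rewriting {t} h = begin
    T                      ≈⟨ identityʳ _ ⟨
    T ∙ ε                  ≡⟨ cong (λ w → T ∙ ⟦ w ⟧) base ⟨
    T ∙ ⟦ rep (ε ∙ t) ⟧    ≈⟨ realise-rewriting-∙ ε t ⟩
    ⟦ rep ε ⟧ ∙ t          ≡⟨ cong (λ w → ⟦ w ⟧ ∙ t) []-vertex ⟩
    ε ∙ t                  ≈⟨ identityˡ _ ⟩
    t                      ∎
    where
    T = proj₁ (realise (rewriting ε t))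
    base : rep (ε ∙ t) ≡ []
    base = trans (rep-cong (∼-trans (≈⇒∼ (identityˡ t)) (Member⇒∼ε h))) []-vertex

  -- Of the three stretches of the cycle, only the middle one leaves the tree.
  rewriting-cycle : ∀ e → rewriting ε (proj₁ (cycle e)) F.≈ gen e
  rewriting-cycle e@(edge u x uv ux) = F.trans
    (F.∙-cong
      (F.∙-cong (rewriting-vertex u uv′)
        (F.reflexive (trans (letter-cong {vv = uv} x (trans (rep-cong (≈⇒∼ (identityˡ _))) uv′))
          (letter-edge x ux))))
      -- The return stretch is an inverse, so the path being inverted starts at the end of the whole
      -- cycle, that is, at the base coset.
      (F.⁻¹-cong (F.trans
        (rewriting-≈ (assoc ε (⟦ u ⟧ ∙ gen x) (⟦ target u x ⟧ ⁻¹)) ⟦ target u x ⟧)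
        (F.trans (F.reflexive (rewriting-member (proj₂ (cycle e)) ⟦ target u x ⟧))
          (rewriting-vertex (target u x) (rep-vertex _))))))
    (F.trans (F.∙-cong (F.identityˡ _) FP.ε⁻¹≈ε) (F.identityʳ _))
    where uv′ = recompute (rep ⟦ u ⟧ ≟ u) uv

  rewriting-realise : ∀ t → rewriting ε (proj₁ (realise t)) F.≈ t
  rewriting-realise (gen e)  = rewriting-cycle e
  rewriting-realise ε′       = F.refl
  rewriting-realise (s ∙′ t) = F.∙-cong (rewriting-realise s)
    (F.trans (F.reflexive (rewriting-member (proj₂ (realise s)) (proj₁ (realise t))))
      (rewriting-realise t))
  rewriting-realise (inv t)  = F.⁻¹-cong
    (F.trans (F.reflexive (rewriting-member (⁻¹-closed (proj₂ (realise t))) (proj₁ (realise t))))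
      (rewriting-realise t))

  subgroup≅ : group ≅ G[ flip ]
  subgroup≅ = rewriting ε ∘ proj₁ , record
    { isGroupMonomorphism = record
      { isGroupHomomorphism = record
        { isMonoidHomomorphism = record
          { isMagmaHomomorphism = record
            { isRelHomomorphism = record { cong = rewriting-cong ε }
            ; homo = λ (_ , x∈) (y , _) → F.∙-congˡ (F.reflexive (rewriting-member x∈ y))
            }
          ; ε-homo = F.refl
          }
        ; ⁻¹-homo = λ (x , x∈) → F.⁻¹-cong (F.reflexive (rewriting-member (⁻¹-closed x∈) x))
        }
      ; injective = λ {(_ , x∈)} {(_ , y∈)} eq →
          ≈trans (≈sym (realise-rewriting x∈)) (≈trans (realise-cong eq) (realise-rewriting y∈))
      }
    ; surjective = λ t → realise t , λ h → F.trans (rewriting-cong ε h) (rewriting-realise t)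
    }

-- Parity of occurrences and finiteness of the alphabet

letters : {A : Set a} → Term A → List A
letters (gen x)  = x ∷ []
letters ε′       = []
letters (s ∙′ t) = letters s ++ letters t
letters (inv t)  = letters t

module Parity {B : Set} (_≟_ : DecidableEquality B) {θ : B → B} (θ-inv : Involutive _≡_ θ) (b : B) where

  -- A disjunction and not a sum: for a letter `b` fixed by `θ`, adding the two tests modulo 2 would
  -- always give zero.
  orbit? : B → Bool
  orbit? x = does (x ≟ b) ∨ does (θ x ≟ b)

  parity : Term B → Bool
  parity (gen x)  = orbit? x
  parity ε′       = false
  parity (s ∙′ t) = parity s xor parity t
  parity (inv t)  = parity t

  -- The two letters of a relation lie in the orbit of `b` together or not at all, so each relation
  -- has even parity.
  orbit?-θ : ∀ x → orbit? x ≡ orbit? (θ x)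
  orbit?-θ x rewrite θ-inv x = ∨-comm (does (x ≟ b)) _

  parity-cong : ∀ {s t} → _≈θ_ θ s t → parity s ≡ parity t
  parity-cong ≈-refl          = refl
  parity-cong (≈-sym h)       = sym (parity-cong h)
  parity-cong (≈-trans h k)   = trans (parity-cong h) (parity-cong k)
  parity-cong (≈-∙-cong h k)  = cong₂ _xor_ (parity-cong h) (parity-cong k)
  parity-cong (≈-inv-cong h)  = parity-cong h
  parity-cong (≈-assoc s t u) = xor-assoc (parity s) _ _
  parity-cong (≈-identityˡ s) = refl
  parity-cong (≈-identityʳ s) = xor-identityʳ _
  parity-cong (≈-inverseˡ s)  = xor-same (parity s)
  parity-cong (≈-inverseʳ s)  = xor-same (parity s)
  parity-cong (relation x)    = trans (cong (orbit? x xor_) (sym (orbit?-θ x))) (xor-same (orbit? x))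

  orbit?-self : orbit? b ≡ true
  orbit?-self rewrite dec-true (b ≟ b) refl = refl

  parity-absent : ∀ t → (∀ {x} → x ∈ˡ letters t → x ≢ b × θ x ≢ b) → parity t ≡ false
  parity-absent (gen x)  h with h (here refl)
  ... | x≢b , θx≢b rewrite dec-false (x ≟ b) x≢b | dec-false (θ x ≟ b) θx≢b = refl
  parity-absent ε′       h = refl
  parity-absent (s ∙′ t) h =
    cong₂ _xor_ (parity-absent s (h ∘ ∈-++⁺ˡ)) (parity-absent t (h ∘ ∈-++⁺ʳ (letters s)))
  parity-absent (inv t)  h = parity-absent t h

module _ {B : Set} (_≟_ : DecidableEquality B) {θ : B → B} (θ-inv : Involutive _≡_ θ)
         (G : Group c ℓ) (iso : G ≅ G[ θ ]) where

  open GroupMorphisms (Group.rawGroup G) (Group.rawGroup G[ θ ])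
  open IsGroupIsomorphism (proj₂ iso)
  open DecMembership _≟_ using (_∈?_)

  private
    f = proj₁ iso

  -- If `b` were missing from the list, the images of all generators would have even parity, and so
  -- would the whole image of `f`; yet `gen b` is odd and `f` is surjective. The list includes
  -- `map θ L` because parity sees only orbits.
  finitelyGenerated⇒finite : FinitelyGenerated G → Finite B
  finitelyGenerated⇒finite (n , g , generates) = enumerated⇒finite _≟_ (L ++ map θ L) covered
    where
    L : List B
    L = concatMap (letters ∘ f ∘ g) (allFin n)

    letters⊆L : ∀ i {x} → x ∈ˡ letters (f (g i)) → x ∈ˡ L
    letters⊆L i x∈ = ∈-concatMap⁺ (letters ∘ f ∘ g) (Any.map (λ { refl → x∈ }) (∈-allFin i))

    covered : ∀ b → b ∈ˡ L ++ map θ L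
    covered b with b ∈? (L ++ map θ L)
    ... | yes b∈ = b∈
    ... | no b∉  = contradiction (trans (sym orbit?-self) (trans (sym (parity-cong fx≈b)) (trans
                     (sym (parity-cong (⟦⟧-cong (proj₂ (generates x))))) (even (proj₁ (generates x)))))) λ ()
      where
      open Parity _≟_ {θ} θ-inv b

      x = proj₁ (surjective (gen b))

      fx≈b = proj₂ (surjective (gen b)) (Group.refl G)

      absent : ∀ {y} → y ∈ˡ L → y ≢ b × θ y ≢ b
      absent y∈ = (λ { refl → b∉ (∈-++⁺ˡ y∈) }) , (λ { refl → b∉ (∈-++⁺ʳ L (∈-map⁺ θ y∈)) })

      even : ∀ t → parity (f (eval G g t)) ≡ false
      even (gen i)  = parity-absent (f (g i)) (absent ∘ letters⊆L i)
      even ε′       = parity-cong ε-homo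
      even (s ∙′ t) = trans (parity-cong (∙-homo _ _)) (cong₂ _xor_ (even s) (even t))
      even (inv t)  = trans (parity-cong (⁻¹-homo _)) (even t)

-- Transport of a subgroup along an isomorphism

module Transport {G : Group c₁ ℓ₁} {K : Group c₂ ℓ₂} (iso : G ≅ K) (H : Subgroup G p) where

  private
    module G = Group G
    module K = Group K
    f = proj₁ iso

  open GroupMorphisms G.rawGroup K.rawGroup
  open IsGroupIsomorphism (proj₂ iso)
  open Subgroup H

  private
    f⁻¹ : K.Carrier → G.Carrier
    f⁻¹ y = proj₁ (surjective y)

    f∘f⁻¹ : ∀ y → f (f⁻¹ y) K.≈ y
    f∘f⁻¹ y = proj₂ (surjective y) G.refl

    f⁻¹-unique : ∀ {x y} → f x K.≈ y → x G.≈ f⁻¹ y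
    f⁻¹-unique fx≈y = injective (K.trans fx≈y (K.sym (f∘f⁻¹ _)))

  -- Pulling membership back along `f⁻¹` keeps it at level `p`, where excluded middle is assumed; an
  -- existential over preimages could raise the level.
  image : Subgroup K p
  image = record
    { Member    = Member ∘ f⁻¹
    ; resp      = λ y≈z → resp (f⁻¹-unique (K.trans (f∘f⁻¹ _) y≈z))
    ; ε-closed  = resp (f⁻¹-unique ε-homo) ε-closed
    ; ∙-closed  = λ y∈ z∈ → resp
        (f⁻¹-unique (K.trans (∙-homo _ _) (K.∙-cong (f∘f⁻¹ _) (f∘f⁻¹ _)))) (∙-closed y∈ z∈)
    ; ⁻¹-closed = λ y∈ → resp (f⁻¹-unique (K.trans (⁻¹-homo _) (K.⁻¹-cong (f∘f⁻¹ _)))) (⁻¹-closed y∈)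
    }

  image≅ : group ≅ Subgroup.group image
  image≅ = (λ (x , x∈) → f x , resp (f⁻¹-unique K.refl) x∈) , record
    { isGroupMonomorphism = record
      { isGroupHomomorphism = record
        { isMonoidHomomorphism = record
          { isMagmaHomomorphism = record
            { isRelHomomorphism = record { cong = ⟦⟧-cong }
            ; homo = λ x y → ∙-homo (proj₁ x) (proj₁ y)
            }
          ; ε-homo = ε-homo
          }
        ; ⁻¹-homo = λ x → ⁻¹-homo (proj₁ x)
        }
      ; injective = injective
      }
    ; surjective = λ (y , y∈) → (f⁻¹ y , y∈) , λ h → K.trans (⟦⟧-cong h) (f∘f⁻¹ y)
    }

≅-trans : {G : Group c₁ ℓ₁} {H : Group c₂ ℓ₂} {K : Group c₃ ℓ₃} → G ≅ H → H ≅ K → G ≅ K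
≅-trans {K = K} (f , f-iso) (g , g-iso) = g ∘ f , isGroupIsomorphism (Group.trans K) f-iso g-iso

theorem3p3 : ∀ {c ℓ p : Level} → ExcludedMiddle p → (G : Group c ℓ) → IsSpecular G →
    (H : Subgroup G p) →
    IsSpecular∞ (Subgroup.group H) × (FinitelyGenerated (Subgroup.group H) → IsSpecular (Subgroup.group H))
-- Both claims use the same alphabet of edges and the same isomorphism; finite generation only
-- bounds the alphabet.
theorem3p3 em G (A , (n , A↔Fin) , θ , θ-inv , G≅) H = (Edge , specular) , λ fg →
    Edge , finitelyGenerated⇒finite _≟ᵉ_ {flip} flip-involutive (Subgroup.group H) H≅ fg , specular
  where
  open Transport {K = G[ θ ]} G≅ H
  open Schreier em (↔⇒↣ A↔Fin) {θ} θ-inv image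

  H≅ : Subgroup.group H ≅ G[ flip ]
  H≅ = ≅-trans {G = Subgroup.group H} {H = Subgroup.group image} {K = G[ flip ]} image≅ subgroup≅

  specular : SpecularOver Edge (Subgroup.group H)
  specular = flip , flip-involutive , H≅
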